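{- Let $n\ge 1$ and $k \ge 1$ be integers. In every proper edge coloring of $K_n$ there is a $k$-rainbow path on at least \[ \left(1-\frac{2}{(k+2)!}\right)n \] vertices.
   Context: A proper edge coloring of a graph $G=(V,E)$ is a map $c\colon E\to \mathbb{N}$ such that any two distinct edges sharing an endpoint receive different colors. Given such a coloring, a $k$-rainbow path is a path in which no color appears on more than $k$ of its edges. -}

module Defs where

open import Data.Nat using (ℕ; zero; suc; _+_; _*_; _∸_; _≤_; _≟_; _!)

open import Data.Fin using (Fin)
open import Data.List using (List; []; _∷_; length; filter; map)
open import Data.List.Relation.Unary.Unique.Propositional using (Unique)
open import Data.Product using (_×_)
open import Data.Empty using (⊥)
open import Relation.Binary.PropositionalEquality using (_≡_; _≢_)

-- An edge coloring of the complete graph K_n on vertex set Fin n: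
-- the color of the edge {u,v} (u ≢ v) is c u v; values c u u are irrelevant.
EdgeColoring : ℕ → Set
EdgeColoring n = Fin n → Fin n → ℕ

Symmetric : {n : ℕ} → EdgeColoring n → Set
Symmetric {n} c = (u v : Fin n) → u ≢ v → c u v ≡ c v u

Proper : {n : ℕ} → EdgeColoring n → Set
Proper {n} c = (u v w : Fin n) → u ≢ v → u ≢ w → v ≢ w → c u v ≢ c u w

ProperEdgeColoring : {n : ℕ} → EdgeColoring n → Set
ProperEdgeColoring c = Symmetric c × Proper c

edgeColors : {n : ℕ} → EdgeColoring n → List (Fin n) → List ℕ
edgeColors c [] = []
edgeColors c (x ∷ []) = []
edgeColors c (x ∷ y ∷ xs) = c x y ∷ edgeColors c (y ∷ xs)

count : ℕ → List ℕ → ℕ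
count a xs = length (filter (a ≟_) xs)

-- a path in K_n: a nonempty sequence of pairwise distinct vertices
-- (every pair of distinct vertices is adjacent in K_n)
IsPath : {n : ℕ} → List (Fin n) → Set
IsPath [] = ⊥
IsPath (x ∷ xs) = Unique (x ∷ xs)

KRainbow : {n : ℕ} → ℕ → EdgeColoring n → List (Fin n) → Set
KRainbow k c P = (a : ℕ) → count a (edgeColors c P) ≤ k

module Submission where

-- Induction on k, from a single vertex at k = 0: a k-rainbow path missing u′ vertices
-- yields a (k+1)-rainbow path missing u vertices with (k+3) u ≤ u′, and multiplying these
-- ratios gives the factorial.  Among the (k+1)-rainbow paths with at most as many saturated
-- colours (those used k+1 times) as vertices gained, take a longest one, v₁ … vₚ.  All u
-- edges from vₚ to missing vertices have saturated colours, so u (k+1) path edges vᵢvᵢ₊₁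
-- carry these colours.  The edges from v₁ to the missing vertices and to those vᵢ₊₁ are
-- saturated too: an unsaturated v₁vᵢ₊₁ could replace vᵢvᵢ₊₁, freeing its colour for an
-- extension at vₚ.  Either way of extending gains a vertex and saturates at most one colour,
-- so it stays in the class.  Hence v₁ sees (k+2) u saturated colours, while at most u′ − u
-- exist.

open import Defs
open import Data.Nat using (ℕ; zero; suc; _*_; _∸_; _≤_; _<_; _+_; _!; _≟_; _≤?_; z≤n; s≤s)
open import Data.Nat.Properties hiding (_≟_; _≤?_)
open import Data.Nat.Tactic.RingSolver using (solve-∀)
open import Data.Fin using (Fin; fromℕ<)
import Data.Fin.Properties as Fin
open import Data.List using (List; []; _∷_; [_]; _++_; _ʳ++_; length; map; filter; allFin)
open import Data.List.Properties
  using (length-++; length-map; length-tabulate; filter-accept; filter-reject;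
         ++-assoc; ++-identityʳ)
open import Data.List.Membership.Propositional using (_∈_; _∉_; find)
open import Data.List.Membership.Propositional.Properties
  using (∈-∃++; ∈-allFin; ∈-filter⁺; ∈-filter⁻; ∈-map⁺; ∈-map⁻; ∈-++⁺ˡ; ∈-++⁺ʳ; ∈-++⁻)
import Data.List.Membership.DecPropositional as DecMembership
open import Data.List.Relation.Unary.All as All using (All; []; _∷_; all?)
open import Data.List.Relation.Unary.All.Properties using (¬All⇒Any¬; All¬⇒¬Any; ¬Any⇒All¬; ++⁻ˡ)
open import Data.List.Relation.Unary.AllPairs as AllPairs using (AllPairs; []; _∷_)
import Data.List.Relation.Unary.AllPairs.Properties as AllPairs
open import Data.List.Relation.Unary.Any using (here; there)
open import Data.List.Relation.Unary.Unique.Propositional using (Unique)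
open import Data.List.Relation.Unary.Unique.Propositional.Properties as Unique using (allFin⁺)
open import Data.List.Relation.Binary.Permutation.Propositional
  using (_↭_; ↭-refl; ↭-sym; ↭-trans; ↭-reflexive; ↭⇒↭ₛ; prep; swap; module PermutationReasoning)
open import Data.List.Relation.Binary.Permutation.Propositional.Properties
  using (shift; ∈-resp-↭; ↭-length; filter-↭; ++↭ʳ++; ++⁺ˡ; ¬x∷xs↭[]; ++-comm)
open import Data.List.Relation.Binary.Permutation.Setoid.Properties using (Unique-resp-↭)
open import Data.Product using (Σ; ∃₂; _×_; _,_; proj₁; proj₂; uncurry)
open import Data.Sum using (_⊎_; inj₁; inj₂; [_,_]′)
open import Function using (_∘_)
open import Relation.Nullary using (Dec; yes; no; contradiction; ¬?)
open import Relation.Nullary.Decidable using (toSum)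
open import Relation.Binary.PropositionalEquality
  using (_≡_; _≢_; refl; sym; trans; cong; subst; setoid)

open DecMembership _≟_ using () renaming (_∈?_ to _∈ℕ?_)

-- Counting with duplicate-free lists and colour multiplicities.

unique-⊆⇒length≤ : {A : Set} {xs ys : List A} → Unique xs →
  (∀ {x} → x ∈ xs → x ∈ ys) → length xs ≤ length ys
unique-⊆⇒length≤ [] _ = z≤n
unique-⊆⇒length≤ {A} {x ∷ xs} (x∉ ∷ xs!) sub with ∈-∃++ (sub (here refl))
... | as , bs , refl = ≤-trans (s≤s (unique-⊆⇒length≤ xs! sub′))
                               (≤-reflexive (sym (↭-length (shift x as bs))))
  where
  sub′ : ∀ {y} → y ∈ xs → y ∈ as ++ bs
  sub′ y∈ with ∈-resp-↭ (shift x as bs) (sub (there y∈))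
  ... | here y≡x = contradiction (sym y≡x) (All.lookup x∉ y∈)
  ... | there y∈′ = y∈′

count-↭ : ∀ a {xs ys} → xs ↭ ys → count a xs ≡ count a ys
count-↭ a p = ↭-length (filter-↭ (a ≟_) p)

count-∷-≡ : ∀ {a b} xs → a ≡ b → count a (b ∷ xs) ≡ suc (count a xs)
count-∷-≡ xs a≡b = cong length (filter-accept (_ ≟_) a≡b)

count-∷-≢ : ∀ {a b} xs → a ≢ b → count a (b ∷ xs) ≡ count a xs
count-∷-≢ xs a≢b = cong length (filter-reject (_ ≟_) a≢b)

module _ {A : Set} (f : A → ℕ) where

  keyedIn : List ℕ → List A → List A
  keyedIn B = filter (λ e → f e ∈ℕ? B)

  -- Since `b ∉ B`, no entry is counted in both summands on the left.
  count+keyedIn≤ : ∀ {b B} → b ∉ B → ∀ es →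
    count b (map f es) + length (keyedIn B es) ≤ length (keyedIn (b ∷ B) es)
  count+keyedIn≤ b∉B [] = z≤n
  count+keyedIn≤ {b} {B} b∉B (e ∷ es) = go (b ≟ f e) (f e ∈ℕ? B)
    where
    open ≤-Reasoning
    ih = count+keyedIn≤ b∉B es
    accept : ∀ {B} → f e ∈ B → keyedIn B (e ∷ es) ≡ e ∷ keyedIn B es
    accept {B} = filter-accept (λ e → f e ∈ℕ? B)
    reject : ∀ {B} → f e ∉ B → keyedIn B (e ∷ es) ≡ keyedIn B es
    reject {B} = filter-reject (λ e → f e ∈ℕ? B)
    go : Dec (b ≡ f e) → Dec (f e ∈ B) →
      count b (f e ∷ map f es) + length (keyedIn B (e ∷ es)) ≤ length (keyedIn (b ∷ B) (e ∷ es))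
    go (yes b≡fe) _
      rewrite count-∷-≡ (map f es) b≡fe
            | reject (λ fe∈B → b∉B (subst (_∈ B) (sym b≡fe) fe∈B))
            | accept {b ∷ B} (here (sym b≡fe)) = s≤s ih
    go (no b≢fe) (yes fe∈B)
      rewrite count-∷-≢ (map f es) b≢fe
            | accept fe∈B
            | accept {b ∷ B} (there fe∈B) = ≤-trans (≤-reflexive (+-suc _ _)) (s≤s ih)
    go (no b≢fe) (no fe∉B)
      rewrite count-∷-≢ (map f es) b≢fe
            | reject fe∉B
            | reject {b ∷ B} (λ { (here fe≡b) → b≢fe (sym fe≡b) ; (there fe∈B) → fe∉B fe∈B }) = ih

  -- Distinct keys claim disjoint sets of at least `K` entries each. With `K` equal to `k + 1` this
  -- bounds from below the number of path edges that carry given saturated colours.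
  length*≤keyedIn : ∀ {K B} es → Unique B → All (λ b → K ≤ count b (map f es)) B →
    length B * K ≤ length (keyedIn B es)
  length*≤keyedIn es [] [] = z≤n
  length*≤keyedIn es (b∉ ∷ B!) (K≤ ∷ K≤s) =
    ≤-trans (+-mono-≤ K≤ (length*≤keyedIn es B! K≤s)) (count+keyedIn≤ (All¬⇒¬Any b∉) es)

-- Vertices and edges of a path given by its first vertex and the rest.

lastFrom : {A : Set} → A → List A → A
lastFrom x [] = x
lastFrom x (y ∷ ys) = lastFrom y ys

lastFrom-∈ : {A : Set} (x : A) (xs : List A) → lastFrom x xs ∈ x ∷ xs
lastFrom-∈ x [] = here refl
lastFrom-∈ x (y ∷ ys) = there (lastFrom-∈ y ys)

lastFrom-++ : {A : Set} (x : A) (as : List A) {b : A} {bs : List A} →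
  lastFrom x (as ++ b ∷ bs) ≡ lastFrom b bs
lastFrom-++ x [] = refl
lastFrom-++ x (a ∷ as) = lastFrom-++ a as

edges : {A : Set} → A → List A → List (A × A)
edges x [] = []
edges x (y ∷ ys) = (x , y) ∷ edges y ys

map-proj₂-edges : {A : Set} (x : A) (xs : List A) → map proj₂ (edges x xs) ≡ xs
map-proj₂-edges x [] = refl
map-proj₂-edges x (y ∷ ys) = cong (y ∷_) (map-proj₂-edges y ys)

∈-edges⇒split : {A : Set} {a b : A} (x : A) (xs : List A) → (a , b) ∈ edges x xs →
  ∃₂ λ as bs → xs ≡ as ++ b ∷ bs × lastFrom x as ≡ a
∈-edges⇒split x (y ∷ ys) (here refl) = [] , ys , refl , refl
∈-edges⇒split x (y ∷ ys) (there e∈) with ∈-edges⇒split y ys e∈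
... | as , bs , refl , eq = y ∷ as , bs , refl , eq

unique-++⁻ˡ : {A : Set} {xs ys : List A} → Unique (xs ++ ys) → Unique xs
unique-++⁻ˡ {xs = []} _ = []
unique-++⁻ˡ {xs = x ∷ xs} (x∉ ∷ u) = ++⁻ˡ xs x∉ ∷ unique-++⁻ˡ u

∷-unique⁺ : {A : Set} {w : A} {xs : List A} → w ∉ xs → Unique xs → Unique (w ∷ xs)
∷-unique⁺ w∉ xs! = ¬Any⇒All¬ _ w∉ ∷ xs!

∉⇒≢ : {A : Set} {w x : A} {xs : List A} → w ∉ xs → x ∈ xs → x ≢ w
∉⇒≢ w∉ x∈ refl = w∉ x∈

++∷-↭ : {A : Set} (xs : List A) (w : A) → xs ++ [ w ] ↭ w ∷ xs
++∷-↭ xs w = ++-comm xs [ w ]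

unique⇒isPath : ∀ {n x} {Q P : List (Fin n)} → Unique P → P ↭ x ∷ Q → IsPath P
unique⇒isPath {P = []} _ p = ¬x∷xs↭[] (↭-sym p)
unique⇒isPath {P = _ ∷ _} P! _ = P!

isPath⇒unique : ∀ {n} {P : List (Fin n)} → IsPath P → Unique P
isPath⇒unique {P = _ ∷ _} P! = P!

-- Here `m` and `p` are the lengths of the old and the new path, `u` counts the missing vertices and
-- `s` the listed colours. The first three hypotheses give `(3 + k) * (n - p)` at most `n - m`, and
-- by the last one `f` times this is at most `2 * n`. With `f` equal to `(2 + k) !`, the factor
-- `(3 + k) * f` is the next factorial.
factorial-step : ∀ n k f m p u s → n ≤ u + p → (2 + k) * u ≤ s → s + m ≤ p →
  f * n ≤ f * m + 2 * n → (3 + k) * f * n ≤ (3 + k) * f * p + 2 * n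
factorial-step n k f m p u s n≤ u≤ s≤ ih = begin
  (3 + k) * f * n                       ≡⟨ lhs k f n ⟩
  f * ((2 + k) * n) + f * n             ≤⟨ +-monoʳ-≤ (f * ((2 + k) * n)) ih ⟩
  f * ((2 + k) * n) + (f * m + 2 * n)   ≡⟨ mid k f n m ⟩
  f * ((2 + k) * n + m) + 2 * n         ≤⟨ +-monoˡ-≤ (2 * n) (*-monoʳ-≤ f key) ⟩
  f * ((3 + k) * p) + 2 * n             ≡⟨ rhs k f p n ⟩
  (3 + k) * f * p + 2 * n               ∎
  where
  open ≤-Reasoning
  lhs : ∀ k f n → (3 + k) * f * n ≡ f * ((2 + k) * n) + f * n
  lhs = solve-∀
  mid : ∀ k f n m → f * ((2 + k) * n) + (f * m + 2 * n) ≡ f * ((2 + k) * n + m) + 2 * n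
  mid = solve-∀
  rhs : ∀ k f p n → f * ((3 + k) * p) + 2 * n ≡ (3 + k) * f * p + 2 * n
  rhs = solve-∀
  regroup : ∀ k u p m → (2 + k) * (u + p) + m ≡ ((2 + k) * u + m) + (2 + k) * p
  regroup = solve-∀
  key : (2 + k) * n + m ≤ (3 + k) * p
  key = begin
    (2 + k) * n + m                    ≤⟨ +-monoˡ-≤ m (*-monoʳ-≤ (2 + k) n≤) ⟩
    (2 + k) * (u + p) + m              ≡⟨ regroup k u p m ⟩
    ((2 + k) * u + m) + (2 + k) * p    ≤⟨ +-monoˡ-≤ _ (≤-trans (+-monoˡ-≤ m u≤) s≤) ⟩
    (3 + k) * p                        ∎

-- Colours along a path, missing vertices and grown paths.

module _ {n : ℕ} (c : EdgeColoring n) where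

  open DecMembership (Fin._≟_ {n}) using () renaming (_∈?_ to _∈V?_)

  edgeColors≡map : ∀ x xs → edgeColors c (x ∷ xs) ≡ map (uncurry c) (edges x xs)
  edgeColors≡map x [] = refl
  edgeColors≡map x (y ∷ ys) = cong (c x y ∷_) (edgeColors≡map y ys)

  -- Only multiplicities of colours matter, so their order is given up and the colour of the joining
  -- edge comes first.
  edgeColors-++ : ∀ x as b bs →
    edgeColors c (x ∷ as ++ b ∷ bs) ↭
    c (lastFrom x as) b ∷ edgeColors c (x ∷ as) ++ edgeColors c (b ∷ bs)
  edgeColors-++ x [] b bs = ↭-refl
  edgeColors-++ x (a ∷ as) b bs =
    ↭-trans (prep _ (edgeColors-++ a as b bs)) (swap _ _ ↭-refl)

  edgeColors-∷ʳ : ∀ x xs w →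
    edgeColors c (x ∷ xs ++ [ w ]) ↭ c (lastFrom x xs) w ∷ edgeColors c (x ∷ xs)
  edgeColors-∷ʳ x xs w =
    ↭-trans (edgeColors-++ x xs w []) (prep _ (↭-reflexive (++-identityʳ _)))

  outside : List (Fin n) → List (Fin n)
  outside P = filter (λ w → ¬? (w ∈V? P)) (allFin n)

  ∈-outside⁻ : ∀ {w P} → w ∈ outside P → w ∉ P
  ∈-outside⁻ {P = P} w∈ = proj₂ (∈-filter⁻ (λ w → ¬? (w ∈V? P)) {xs = allFin n} w∈)

  n≤outside+length : ∀ P → n ≤ length (outside P) + length P
  n≤outside+length P = begin
    n                               ≡⟨ length-tabulate {n = n} (λ i → i) ⟨
    length (allFin n)               ≤⟨ unique-⊆⇒length≤ (allFin⁺ n) (λ {v} _ → cover v) ⟩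
    length (outside P ++ P)         ≡⟨ length-++ (outside P) ⟩
    length (outside P) + length P   ∎
    where
    open ≤-Reasoning
    cover : ∀ v → v ∈ outside P ++ P
    cover v with v ∈V? P
    ... | yes v∈ = ∈-++⁺ʳ (outside P) v∈
    ... | no v∉ = ∈-++⁺ˡ (∈-filter⁺ (λ w → ¬? (w ∈V? P)) (∈-allFin v) v∉)

  unique⇒length≤n : ∀ {P : List (Fin n)} → Unique P → length P ≤ n
  unique⇒length≤n P! =
    ≤-trans (unique-⊆⇒length≤ P! (λ {v} _ → ∈-allFin v)) (≤-reflexive (length-tabulate {n = n} (λ i → i)))

  -- S contains every colour that occurs k + 1 times on P, so it counts the colours
  -- for which P spends more than a k-rainbow path may; m is the number of vertices
  -- of the k-rainbow path from which P was grown.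
  record Grown (k m : ℕ) (P : List (Fin n)) (S : List ℕ) : Set where
    field
      isPath    : IsPath P
      bounded   : KRainbow (suc k) c P
      saturated : ∀ a → a ∉ S → count a (edgeColors c P) ≤ k
      budget    : length S + m ≤ length P

  -- Vertices and colours enter only up to permutation, so one statement serves extension at either
  -- end and after a rotation. The colour `γ` joins the list whether or not it has become saturated;
  -- the new vertex pays for it.
  grow : ∀ {k m P Q S γ w} → Grown k m P S → w ∉ P → Q ↭ w ∷ P →
    edgeColors c Q ↭ γ ∷ edgeColors c P → count γ (edgeColors c P) ≤ k → Grown k m Q (γ ∷ S)
  grow {k} {m} {P} {Q} {S} {γ} g w∉P Q↭ col↭ γ≤k = record
    { isPath = unique⇒isPath
        (Unique-resp-↭ (setoid _) (↭⇒↭ₛ (↭-sym Q↭)) (∷-unique⁺ w∉P (isPath⇒unique isPath))) Q↭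
    ; bounded = λ a → ≤-trans (≤-reflexive (count-↭ a col↭)) (bounded′ a)
    ; saturated = λ a a∉ → ≤-trans
        (≤-reflexive (trans (count-↭ a col↭) (count-∷-≢ _ (a∉ ∘ here))))
        (saturated a (a∉ ∘ there))
    ; budget = ≤-trans (s≤s budget) (≤-reflexive (sym (↭-length Q↭)))
    }
    where
    open Grown g
    bounded′ : ∀ a → count a (γ ∷ edgeColors c P) ≤ suc k
    bounded′ a = [ (λ a≡γ → ≤-trans (≤-reflexive (count-∷-≡ _ a≡γ))
                              (s≤s (subst (λ b → count b (edgeColors c P) ≤ k) (sym a≡γ) γ≤k)))
                 , (λ a≢γ → ≤-trans (≤-reflexive (count-∷-≢ _ a≢γ)) (bounded a)) ]′
                 (toSum (a ≟ γ))

  -- Proper colourings: distinct colours at a vertex, and rotations of paths.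

  module _ (proper : ProperEdgeColoring c) where

    c-sym : Symmetric c
    c-sym = proj₁ proper

    unique-colors : ∀ {x X} → All (x ≢_) X → Unique X → Unique (map (c x) X)
    unique-colors {x} x≢ X! = AllPairs.map⁺ (go x≢ X!)
      where
      go : ∀ {X} → All (x ≢_) X → Unique X → AllPairs (λ u v → c x u ≢ c x v) X
      go [] [] = []
      go (x≢u ∷ x≢) (u∉ ∷ X!) =
        All.zipWith (λ (x≢v , u≢v) → proj₂ proper _ _ _ x≢u x≢v u≢v) (x≢ , u∉) ∷ go x≢ X!

    -- Reversing the initial segment makes `x` the neighbour of `b`. The reversed edges keep their
    -- colours by symmetry, which applies because the vertices of the segment are distinct.
    edgeColors-ʳ++ : ∀ x as b bs → Unique (x ∷ as) →
      edgeColors c ((x ∷ as) ʳ++ (b ∷ bs)) ↭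
      c x b ∷ edgeColors c (x ∷ as) ++ edgeColors c (b ∷ bs)
    edgeColors-ʳ++ x [] b bs _ = ↭-refl
    edgeColors-ʳ++ x (a ∷ as) b bs ((x≢a ∷ _) ∷ as!) = begin
      edgeColors c ((a ∷ as) ʳ++ (x ∷ b ∷ bs))
        ↭⟨ edgeColors-ʳ++ a as x (b ∷ bs) as! ⟩
      c a x ∷ edgeColors c (a ∷ as) ++ c x b ∷ edgeColors c (b ∷ bs)
        ≡⟨ cong (_∷ (edgeColors c (a ∷ as) ++ c x b ∷ edgeColors c (b ∷ bs))) (c-sym a x (x≢a ∘ sym)) ⟩
      c x a ∷ edgeColors c (a ∷ as) ++ c x b ∷ edgeColors c (b ∷ bs)
        ↭⟨ shift (c x b) (c x a ∷ edgeColors c (a ∷ as)) (edgeColors c (b ∷ bs)) ⟩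
      c x b ∷ c x a ∷ edgeColors c (a ∷ as) ++ edgeColors c (b ∷ bs) ∎
      where open PermutationReasoning

    -- Trading the edge ab of the path for xb frees the colour of ab, which then pays
    -- for the edge from the far end to w.
    rotate-extend : ∀ x as b bs w → Unique (x ∷ as) →
      c (lastFrom x as) b ≡ c (lastFrom b bs) w →
      edgeColors c ((x ∷ as) ʳ++ (b ∷ bs ++ [ w ])) ↭ c x b ∷ edgeColors c (x ∷ as ++ b ∷ bs)
    rotate-extend x as b bs w as! eq = begin
      edgeColors c ((x ∷ as) ʳ++ (b ∷ bs ++ [ w ]))
        ↭⟨ edgeColors-ʳ++ x as b (bs ++ [ w ]) as! ⟩
      c x b ∷ E ++ edgeColors c (b ∷ bs ++ [ w ])
        ↭⟨ prep _ (++⁺ˡ E (edgeColors-∷ʳ b bs w)) ⟩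
      c x b ∷ E ++ c (lastFrom b bs) w ∷ edgeColors c (b ∷ bs)
        ↭⟨ prep _ (shift _ E _) ⟩
      c x b ∷ c (lastFrom b bs) w ∷ E ++ edgeColors c (b ∷ bs)
        ≡⟨ cong (λ γ → c x b ∷ γ ∷ E ++ edgeColors c (b ∷ bs)) eq ⟨
      c x b ∷ c (lastFrom x as) b ∷ E ++ edgeColors c (b ∷ bs)
        ↭⟨ prep _ (edgeColors-++ x as b bs) ⟨
      c x b ∷ edgeColors c (x ∷ as ++ b ∷ bs) ∎
      where
      open PermutationReasoning
      E = edgeColors c (x ∷ as)

    Larger : ℕ → ℕ → List (Fin n) → Set
    Larger k m P = Σ (List (Fin n)) λ Q → Σ (List ℕ) λ S → Grown k m Q S × length P < length Q

    -- One step: a larger path, or a bound on the missing vertices.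

    module Step {k m : ℕ} {x : Fin n} {xs : List (Fin n)} {S : List ℕ}
                (g : Grown k m (x ∷ xs) S) where

      open Grown g

      private
        P = x ∷ xs
        U = outside P
        l = lastFrom x xs

        U! : Unique U
        U! = Unique.filter⁺ (λ w → ¬? (w ∈V? P)) (allFin⁺ n)

        xs! : Unique xs
        xs! = AllPairs.tail isPath

        larger : ∀ {Q γ w} → w ∉ P → Q ↭ w ∷ P → edgeColors c Q ↭ γ ∷ edgeColors c P →
          count γ (edgeColors c P) ≤ k → Larger k m P
        larger w∉ Q↭ col↭ γ≤k =
          _ , _ , grow g w∉ Q↭ col↭ γ≤k , ≤-reflexive (sym (↭-length Q↭))

      extend-last : ∀ {w} → w ∈ U → count (c l w) (edgeColors c P) ≤ k → Larger k m P
      extend-last {w} w∈ = larger (∈-outside⁻ w∈) (++∷-↭ P w) (edgeColors-∷ʳ x xs w)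

      extend-head : ∀ {w} → w ∈ U → c x w ∉ S → Larger k m P
      extend-head {w} w∈ ∉S = larger w∉ ↭-refl
        (↭-reflexive (cong (_∷ edgeColors c P) (c-sym w x (∉⇒≢ w∉ (here refl) ∘ sym)))) (saturated _ ∉S)
        where w∉ = ∈-outside⁻ w∈

      extend-rotated : ∀ {a b w} → w ∈ U → (a , b) ∈ edges x xs → c a b ≡ c l w → c x b ∉ S →
        Larger k m P
      extend-rotated {w = w} w∈ e∈ eq ∉S with ∈-edges⇒split x xs e∈
      ... | as , bs , refl , refl = larger (∈-outside⁻ w∈)
        (↭-trans (↭-sym (++↭ʳ++ (x ∷ as) _))
          (↭-trans (↭-reflexive (sym (++-assoc (x ∷ as) _ _))) (++∷-↭ P w)))
        (rotate-extend x as _ bs w (unique-++⁻ˡ isPath)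
          (trans eq (cong (λ v → c v w) (lastFrom-++ x as))))
        (saturated _ ∉S)

      B : List ℕ
      B = map (c l) U

      B! : Unique B
      B! = unique-colors (All.tabulate (λ w∈ → ∉⇒≢ (∈-outside⁻ w∈) (lastFrom-∈ x xs))) U!

      -- An edge `(a , b)` listed here can be traded for the edge from `x` to `b`: its colour is
      -- that of an edge from `l` to some missing vertex.
      T : List (Fin n × Fin n)
      T = keyedIn (uncurry c) B (edges x xs)

      T-∈⁻ : ∀ {v} → v ∈ map proj₂ T → Σ (Fin n) λ a → (a , v) ∈ edges x xs × c a v ∈ B
      T-∈⁻ v∈ with ∈-map⁻ proj₂ v∈
      ... | (a , _) , e∈T , refl
        with ∈-filter⁻ (λ e → uncurry c e ∈ℕ? B) {xs = edges x xs} e∈T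
      ... | e∈ , ∈B = a , e∈ , ∈B

      T⊆xs : ∀ {v} → v ∈ map proj₂ T → v ∈ xs
      T⊆xs v∈ = subst (_ ∈_) (map-proj₂-edges x xs) (∈-map⁺ proj₂ (proj₁ (proj₂ (T-∈⁻ v∈))))

      -- The vertices whose edge from `x` yields a larger path as soon as its colour lies outside
      -- `S`.
      X : List (Fin n)
      X = U ++ map proj₂ T

      X! : Unique X
      X! = Unique.++⁺ U!
        -- The second ends of all path edges form `xs`, which has no repetition; this passes to the
        -- sublist `T`.
        (AllPairs.map⁺ (AllPairs.filter⁺ (λ e → uncurry c e ∈ℕ? B)
          (AllPairs.map⁻ (subst Unique (sym (map-proj₂-edges x xs)) xs!))))
        (λ (v∈U , v∈T) → ∈-outside⁻ v∈U (there (T⊆xs v∈T)))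

      x∉X : All (x ≢_) X
      x∉X = All.tabulate λ {v} v∈ →
        [ (λ v∈U → ∉⇒≢ (∈-outside⁻ v∈U) (here refl))
        , (λ v∈T → All.lookup (AllPairs.head isPath) (T⊆xs v∈T)) ]′ (∈-++⁻ U v∈)

      extend-X : ∀ {v} → v ∈ X → c x v ∉ S → Larger k m P
      extend-X v∈ ∉S with ∈-++⁻ U v∈
      ... | inj₁ v∈U = extend-head v∈U ∉S
      ... | inj₂ v∈T with T-∈⁻ v∈T
      ... | a , e∈ , ∈B with ∈-map⁻ (c l) ∈B
      ... | w , w∈ , eq = extend-rotated w∈ e∈ eq ∉S

      maximal-bound : All (λ w → suc k ≤ count (c l w) (edgeColors c P)) U →
        All (λ v → c x v ∈ S) X → (2 + k) * length U ≤ length S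
      maximal-bound U-sat X-sat = begin
        (2 + k) * length U            ≡⟨ cong (length U +_) (*-comm (suc k) (length U)) ⟩
        length U + length U * suc k   ≡⟨ cong (λ b → length U + b * suc k) (length-map (c l) U) ⟨
        -- Each of the distinct colours in `B` occupies at least `k + 1` edges of the path.
        length U + length B * suc k   ≤⟨ +-monoʳ-≤ (length U) (length*≤keyedIn (uncurry c) (edges x xs) B! B-sat) ⟩
        length U + length T           ≡⟨ cong (length U +_) (length-map proj₂ T) ⟨
        length U + length (map proj₂ T) ≡⟨ length-++ U ⟨
        length X                      ≡⟨ length-map (c x) X ⟨
        length (map (c x) X)          ≤⟨ unique-⊆⇒length≤ (unique-colors x∉X X!) ⊆S ⟩
        length S                      ∎
        where
        open ≤-Reasoning
        ⊆S : ∀ {γ} → γ ∈ map (c x) X → γ ∈ S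
        ⊆S γ∈ with ∈-map⁻ (c x) γ∈
        ... | v , v∈ , refl = All.lookup X-sat v∈
        B-sat : All (λ β → suc k ≤ count β (map (uncurry c) (edges x xs))) B
        B-sat = All.tabulate λ β∈ → sat (∈-map⁻ (c l) β∈)
          where
          sat : ∀ {β} → Σ (Fin n) (λ w → w ∈ U × β ≡ c l w) →
            suc k ≤ count β (map (uncurry c) (edges x xs))
          sat (w , w∈ , refl) =
            subst (λ E → suc k ≤ count (c l w) E) (edgeColors≡map x xs) (All.lookup U-sat w∈)

      larger-or-bound : Larger k m P ⊎ (2 + k) * length U ≤ length S
      larger-or-bound with all? (λ w → suc k ≤? count (c l w) (edgeColors c P)) U
      ... | no ¬sat with find (¬All⇒Any¬ (λ w → suc k ≤? count (c l w) (edgeColors c P)) U ¬sat)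
      ...   | w , w∈ , k≮ = inj₁ (extend-last w∈ (≮⇒≥ k≮))
      larger-or-bound | yes U-sat with all? (λ v → c x v ∈ℕ? S) X
      ... | no ¬sat with find (¬All⇒Any¬ (λ v → c x v ∈ℕ? S) X ¬sat)
      ...   | v , v∈ , ∉S = inj₁ (extend-X v∈ ∉S)
      larger-or-bound | yes U-sat | yes X-sat = inj₂ (maximal-bound U-sat X-sat)

    -- Iterating the step, and the induction on `k`.

    maximal : ∀ {k m} fuel {P S} → Grown k m P S → n ≤ fuel + length P →
      Σ (List (Fin n)) λ Q → Σ (List ℕ) λ R →
        Grown k m Q R × (2 + k) * length (outside Q) ≤ length R
    maximal fuel {[]} g _ with () ← Grown.isPath g
    maximal fuel {P@(_ ∷ _)} g n≤ with Step.larger-or-bound g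
    ... | inj₂ bound = P , _ , g , bound
    -- `fuel` bounds the number of vertices off the path, so at zero the path already has `n`
    -- vertices and cannot be outgrown.
    maximal zero {_ ∷ _} g n≤ | inj₁ (Q , S , g′ , P<Q) =
      contradiction (<-≤-trans P<Q (unique⇒length≤n (isPath⇒unique (Grown.isPath g′)))) (≤⇒≯ n≤)
    maximal (suc fuel) {_ ∷ _} g n≤ | inj₁ (Q , S , g′ , P<Q) =
      maximal fuel g′ (≤-trans n≤ (≤-trans (≤-reflexive (sym (+-suc fuel _))) (+-monoʳ-≤ fuel P<Q)))

    -- The bound of the theorem, cleared of denominators and with the negative term moved across to
    -- avoid truncated subtraction.
    LongRainbowPath : ℕ → Set
    LongRainbowPath k = Σ (List (Fin n)) λ P →
      IsPath P × KRainbow k c P × (2 + k) ! * n ≤ (2 + k) ! * length P + 2 * n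

    longRainbowPath : 1 ≤ n → ∀ k → LongRainbowPath k
    -- For `k` zero the factorial is 2, so the bound reads `2 * n ≤ 2 * 1 + 2 * n` and a single
    -- vertex meets it.
    longRainbowPath 1≤n zero = fromℕ< 1≤n ∷ [] , [] ∷ [] , (λ _ → z≤n) , m≤n+m (2 * n) (2 * 1)
    longRainbowPath 1≤n (suc k) with longRainbowPath 1≤n k
    ... | P , isPath , rainbow , ih with maximal n start (m≤m+n n _)
      where
      -- No colour occurs `k + 1` times on a `k`-rainbow path, so the list of saturated colours
      -- starts empty.
      start : Grown k (length P) P []
      start = record
        { isPath = isPath
        ; bounded = λ a → m≤n⇒m≤1+n (rainbow a)
        ; saturated = λ a _ → rainbow a
        ; budget = ≤-refl
        }
    ... | Q , S , g , bound = Q , Grown.isPath g , Grown.bounded g ,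
      factorial-step n k ((2 + k) !) (length P) (length Q) (length (outside Q)) (length S)
        (n≤outside+length Q) bound (Grown.budget g) ih

theorem5 : (n k : ℕ) → 1 ≤ n → 1 ≤ k → (c : EdgeColoring n) → ProperEdgeColoring c →
    Σ (List (Fin n)) (λ P → IsPath P × KRainbow k c P × ((k + 2) ! ∸ 2) * n ≤ (k + 2) ! * length P)
theorem5 n k 1≤n _ c proper rewrite +-comm k 2 with longRainbowPath c proper 1≤n k
... | P , isPath , rainbow , bound = P , isPath , rainbow , (begin
  ((2 + k) ! ∸ 2) * n        ≡⟨ *-distribʳ-∸ n ((2 + k) !) 2 ⟩
  (2 + k) ! * n ∸ 2 * n      ≤⟨ m≤n+o⇒m∸n≤o ((2 + k) ! * n) (2 * n)
                                   (≤-trans bound (≤-reflexive (+-comm _ (2 * n)))) ⟩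
  (2 + k) ! * length P       ∎)
  where open ≤-Reasoning
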